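{- Let $m,n\ge 1$ and let $R=(r_1,\dots,r_m)$ and $S=(s_1,\dots,s_n)$ be vectors of real numbers with $\sum_i r_i=\sum_j s_j$. Then $\mathcal{T}^{+}(R,S)\neq\emptyset$ if and only if $\mathcal{T}^{\infty}(R,S)\neq\emptyset$ and $\mathcal{T}^{0}(R,S)\neq\emptyset$. Likewise, if $R$ and $S$ have nonnegative integer components, then $\mathcal{T}^{+}_{\mathbb{Z}}(R,S)\neq\emptyset$ if and only if $\mathcal{T}^{\infty}_{\mathbb{Z}}(R,S)\neq\emptyset$ and $\mathcal{T}^{0}_{\mathbb{Z}}(R,S)\neq\emptyset$.
   Context: $\mathcal{T}(R,S)$ is the set of $m\times n$ matrices with nonnegative real entries whose $i$th row sum is $r_i$ and whose $j$th column sum is $s_j$ for all $i,j$. On $m\times n$ matrices let $(r_\infty A)_{i,j}=a_{i,\,n+1-j}$ (reflection in a vertical line), $(r_0 A)_{i,j}=a_{m+1-i,\,j}$ (reflection in a horizontal line), $(\rho_\pi A)_{i,j}=a_{m+1-i,\,n+1-j}$ (rotation by $\pi$), $\rho_0$ the identity, and $D_+=\{\rho_0,\rho_\pi,r_0,r_\infty\}$. $\mathcal{T}^{\infty}(R,S)$, $\mathcal{T}^{0}(R,S)$ and $\mathcal{T}^{+}(R,S)$ are the sets of $A\in\mathcal{T}(R,S)$ fixed by $r_\infty$, by $r_0$, and by every element of $D_+$, respectively. A subscript $\mathbb{Z}$ denotes the subset of those matrices all of whose entries are integers. -}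

module Defs where

open import Algebra.Bundles using (CommutativeMonoid)
open import Algebra.Bundles.Raw using (RawMonoid)
import Algebra.Properties.CommutativeSemigroup as CommutativeSemigroupProperties
import Algebra.Definitions.RawMonoid as RawMonoidDefinitions
open import Data.Fin.Base using (Fin; opposite)
open import Data.Integer.Base using (ℤ)
open import Data.Nat.Base as ℕ using (ℕ)
import Data.Nat.Properties as ℕ
open import Data.Product.Base using (∃-syntax; _,_)
open import Data.Rational.Base as ℚ using (ℚ; 0ℚ; ½; ∣_∣)
import Data.Rational.Properties as ℚ
open import Data.Vec.Functional using (Vector)
open import Level using (0ℓ)
open import Relation.Binary.PropositionalEquality using (_≡_; sym; trans; cong; subst)
open import Relation.Unary using (Pred; _∩_; _∈_)

-- Real numbers: Cauchy sequences of rationals, with equality _≃_ of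
-- limits.  There is no quotient, so everything below is stated up to _≃_.

IsCauchy : (ℕ → ℚ) → Set
IsCauchy x = ∀ ε → 0ℚ ℚ.< ε →
  ∃[ N ] (∀ m n → N ℕ.≤ m → N ℕ.≤ n → ∣ x m ℚ.- x n ∣ ℚ.< ε)

record ℝ : Set where
  constructor mkℝ
  field
    seq    : ℕ → ℚ
    cauchy : IsCauchy seq

open ℝ public

infix  4 _≃_ _≤_
infixl 6 _+_

_≃_ : ℝ → ℝ → Set
x ≃ y = ∀ ε → 0ℚ ℚ.< ε →
  ∃[ N ] (∀ n → N ℕ.≤ n → ∣ seq x n ℚ.- seq y n ∣ ℚ.< ε)

-- The slack ε is necessary: the terms of the sequence of x may all exceed
-- those of y although the two limits agree.
_≤_ : ℝ → ℝ → Set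
x ≤ y = ∀ ε → 0ℚ ℚ.< ε →
  ∃[ N ] (∀ n → N ℕ.≤ n → seq x n ℚ.< seq y n ℚ.+ ε)

fromℚ : ℚ → ℝ
fromℚ q = mkℝ (λ _ → q) λ ε 0<ε →
  0 , λ _ _ _ _ → subst (ℚ._< ε) (sym (cong ∣_∣ (ℚ.+-inverseʳ q))) 0<ε

0ℝ : ℝ
0ℝ = fromℚ 0ℚ

fromℤ : ℤ → ℝ
fromℤ k = fromℚ (k ℚ./ 1)

_+_ : ℝ → ℝ → ℝ
x + y = mkℝ (λ n → seq x n ℚ.+ seq y n) cauchy-+
  where
  open CommutativeSemigroupProperties
    (CommutativeMonoid.commutativeSemigroup ℚ.+-0-commutativeMonoid) using (interchange)

  difference : ∀ a b c d → (a ℚ.+ b) ℚ.- (c ℚ.+ d) ≡ (a ℚ.- c) ℚ.+ (b ℚ.- d)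
  difference a b c d = trans
    (cong (a ℚ.+ b ℚ.+_) (ℚ.neg-distrib-+ c d))
    (interchange a b (ℚ.- c) (ℚ.- d))

  halves : ∀ ε → ½ ℚ.* ε ℚ.+ ½ ℚ.* ε ≡ ε
  halves ε = trans (sym (ℚ.*-distribʳ-+ ε ½ ½)) (ℚ.*-identityˡ ε)

  cauchy-+ : IsCauchy (λ n → seq x n ℚ.+ seq y n)
  cauchy-+ ε 0<ε
    with cauchy x (½ ℚ.* ε) (ℚ.*-monoʳ-<-pos ½ 0<ε)
       | cauchy y (½ ℚ.* ε) (ℚ.*-monoʳ-<-pos ½ 0<ε)
  ... | M , hx | N , hy = M ℕ.⊔ N , λ m n p q → begin-strict
    ∣ (seq x m ℚ.+ seq y m) ℚ.- (seq x n ℚ.+ seq y n) ∣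
      ≡⟨ cong ∣_∣ (difference (seq x m) (seq y m) (seq x n) (seq y n)) ⟩
    ∣ (seq x m ℚ.- seq x n) ℚ.+ (seq y m ℚ.- seq y n) ∣
      ≤⟨ ℚ.∣p+q∣≤∣p∣+∣q∣ (seq x m ℚ.- seq x n) (seq y m ℚ.- seq y n) ⟩
    ∣ seq x m ℚ.- seq x n ∣ ℚ.+ ∣ seq y m ℚ.- seq y n ∣
      <⟨ ℚ.+-mono-< (hx m n (ℕ.m⊔n≤o⇒m≤o M N p) (ℕ.m⊔n≤o⇒m≤o M N q))
                    (hy m n (ℕ.m⊔n≤o⇒n≤o M N p) (ℕ.m⊔n≤o⇒n≤o M N q)) ⟩
    ½ ℚ.* ε ℚ.+ ½ ℚ.* ε
      ≡⟨ halves ε ⟩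
    ε ∎
    where open ℚ.≤-Reasoning

+-0-rawMonoid : RawMonoid 0ℓ 0ℓ
+-0-rawMonoid = record { Carrier = ℝ ; _≈_ = _≃_ ; _∙_ = _+_ ; ε = 0ℝ }

open RawMonoidDefinitions +-0-rawMonoid public using (sum)

IsInteger : Pred ℝ 0ℓ
IsInteger x = ∃[ k ] (x ≃ fromℤ k)

Matrix : ℕ → ℕ → Set
Matrix m n = Fin m → Fin n → ℝ

data D₊ : Set where
  ρ₀ ρπ r₀ r∞ : D₊

-- On indices counted from 0, opposite i is n - 1 - i.
act : ∀ {m n} → D₊ → Matrix m n → Matrix m n
act ρ₀ A i j = A i j
act ρπ A i j = A (opposite i) (opposite j)
act r₀ A i j = A (opposite i) j
act r∞ A i j = A i (opposite j)

Fixed : ∀ {m n} → D₊ → Pred (Matrix m n) 0ℓ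
Fixed g A = ∀ i j → act g A i j ≃ A i j

record 𝒯 {m n} (R : Vector ℝ m) (S : Vector ℝ n) (A : Matrix m n) : Set where
  field
    nonNegative : ∀ i j → 0ℝ ≤ A i j
    rowSum      : ∀ i → sum (λ j → A i j) ≃ R i
    columnSum   : ∀ j → sum (λ i → A i j) ≃ S j

IntegerEntries : ∀ {m n} → Pred (Matrix m n) 0ℓ
IntegerEntries A = ∀ i j → IsInteger (A i j)

module _ {m n} (R : Vector ℝ m) (S : Vector ℝ n) where

  𝒯∞ 𝒯⁰ 𝒯⁺ : Pred (Matrix m n) 0ℓ
  𝒯∞ = 𝒯 R S ∩ Fixed r∞
  𝒯⁰ = 𝒯 R S ∩ Fixed r₀
  𝒯⁺ = 𝒯 R S ∩ λ A → ∀ g → A ∈ Fixed g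

  𝒯∞ℤ 𝒯⁰ℤ 𝒯⁺ℤ : Pred (Matrix m n) 0ℓ
  𝒯∞ℤ = 𝒯∞ ∩ IntegerEntries
  𝒯⁰ℤ = 𝒯⁰ ∩ IntegerEntries
  𝒯⁺ℤ = 𝒯⁺ ∩ IntegerEntries

{-# OPTIONS --safe #-}

-- Over the reals, a matrix B ∈ 𝒯⁰ forces R to be symmetric, so for A ∈ 𝒯∞
-- the average of A and r₀ A lies in 𝒯⁺.  Over the integers this average need
-- not be integral.  There, matrices fixed by D₊ are matrices on orbits of
-- indices, where an entry counts twice for each non-central index.  An odd
-- row sum has to be met by an odd entry in the central column, and A shows
-- that the central column sum is large enough for this; B shows the same for
-- the columns.  Once these parities are subtracted, what remains is an
-- ordinary transportation problem.

module Submission where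

module NaturalMatrices where
  open import Data.Fin.Base using (Fin; zero; suc; opposite; inject₁; fromℕ; punchIn)
  open import Data.Fin.Relation.Unary.Top using (view; ‵fromℕ; ‵inject₁; view-fromℕ; view-inject₁)
  open import Data.Nat.Base using (ℕ; zero; suc; _+_; _*_; _∸_; _⊓_; _≤_; ⌊_/2⌋)
  open import Data.Nat.DivMod
    using (_%_; _/_; m≡m%n+[m/n]*n; [m+kn]%n≡m%n; m%n≤m; +-distrib-/-∣ʳ; m*n/n≡m)
  open import Data.Nat.Divisibility using (n∣m*n)
  open import Data.Nat.Properties
  open import Data.Nat.Tactic.RingSolver using (solve-∀)
  open import Data.Product.Base using (∃-syntax; Σ-syntax; _×_; _,_; proj₁; proj₂)
  open import Data.Vec.Functional using (Vector)
  open import Function.Base using (_∘_; flip)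
  open import Relation.Binary.PropositionalEquality
  open import Algebra.Properties.Semiring.Sum +-*-semiring public using (sum)
  open import Algebra.Properties.Semiring.Sum +-*-semiring
    using (sum-cong-≗; sum-init-last; ∑-distrib-+; ∑-comm; *-distribʳ-sum; sum-replicate-zero)

  private variable
    m n : ℕ

  -- Transportation matrices over the natural numbers.

  term≤sum : (s : Vector ℕ n) → ∀ j → s j ≤ sum s
  term≤sum s zero    = m≤m+n (s zero) _
  term≤sum s (suc j) = ≤-trans (term≤sum (s ∘ suc) j) (m≤n+m _ (s zero))

  sum-mono : {s t : Vector ℕ n} → (∀ j → s j ≤ t j) → sum s ≤ sum t
  sum-mono {zero}  s≤t = ≤-refl
  sum-mono {suc n} s≤t = +-mono-≤ (s≤t zero) (sum-mono (s≤t ∘ suc))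

  -- Greedy choice: each position gives up as much of `s j` as `t` still demands, and the truncated
  -- difference `t ∸ s zero` is the demand passed on. In `transport`, `x` becomes a row and `y` the
  -- column sums still to be met.
  split : (s : Vector ℕ n) → ∀ t → t ≤ sum s →
    Σ[ x ∈ Vector ℕ n ] Σ[ y ∈ Vector ℕ n ] (sum x ≡ t × ∀ j → x j + y j ≡ s j)
  split {zero}  s t t≤0 = s , s , sym (n≤0⇒n≡0 t≤0) , λ ()
  split {suc n} s t t≤∑ with split (s ∘ suc) (t ∸ s zero) (m≤n+o⇒m∸n≤o t (s zero) t≤∑)
  ... | x , y , ∑x , x+y =
    (λ { zero → s zero ⊓ t ; (suc j) → x j }) ,
    (λ { zero → s zero ∸ t ; (suc j) → y j }) ,
    trans (cong (s zero ⊓ t +_) ∑x) (m⊓n+n∸m≡n (s zero) t) ,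
    λ { zero    → trans (cong (_+ (s zero ∸ t)) (⊓-comm (s zero) t)) (m⊓n+n∸m≡n t (s zero))
      ; (suc j) → x+y j }

  -- Induction on the rows, as in the northwest corner rule: the first row takes its sum greedily
  -- from the columns, and the totals of the remaining rows and of the reduced columns still agree.
  -- With no rows left, each column sum is bounded by the total 0.
  transport : (r : Vector ℕ m) (s : Vector ℕ n) → sum r ≡ sum s →
    ∃[ Z ] ((∀ i → sum (Z i) ≡ r i) × (∀ j → sum (flip Z j) ≡ s j))
  transport {zero}  r s 0≡∑s = (λ ()) , (λ ()) , λ j →
    sym (n≤0⇒n≡0 (subst (s j ≤_) (sym 0≡∑s) (term≤sum s j)))
  transport {suc m} r s ∑r≡∑s
    with split s (r zero) (subst (r zero ≤_) ∑r≡∑s (term≤sum r zero))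
  ... | x , y , ∑x , x+y
    with transport (r ∘ suc) y (+-cancelˡ-≡ (r zero) _ _ (begin
      sum r                ≡⟨ ∑r≡∑s ⟩
      sum s                ≡⟨ sum-cong-≗ x+y ⟨
      sum (λ j → x j + y j) ≡⟨ ∑-distrib-+ x y ⟩
      sum x + sum y        ≡⟨ cong (_+ sum y) ∑x ⟩
      r zero + sum y       ∎))
    where open ≡-Reasoning
  ... | Z , rows , columns =
    (λ { zero → x ; (suc i) → Z i }) ,
    (λ { zero → ∑x ; (suc i) → rows i }) ,
    λ j → trans (cong (x j +_) (columns j)) (x+y j)

  -- Orbits of indices and symmetric vectors.

  -- The orbits of i ↦ opposite i on Fin m: zero is the centre, which is
  -- missing from Fin m when m is even, and suc k is a pair of indices.
  fold : Fin m → Fin (suc ⌊ m /2⌋)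
  fold {suc zero}    zero = zero
  fold {suc (suc m)} zero = suc zero
  fold {suc (suc m)} (suc i) with view i
  ... | ‵fromℕ     = suc zero
  ... | ‵inject₁ i = punchIn (suc zero) (fold i)

  fold-last : ∀ m → fold (suc (fromℕ m)) ≡ suc zero
  fold-last m rewrite view-fromℕ m = refl

  -- The outermost pair always gets the number `suc zero`, so the inner orbits are renumbered by
  -- `punchIn (suc zero)`: the centre stays `zero` and every inner pair moves up by one.
  fold-inner : (i : Fin m) → fold (suc (inject₁ i)) ≡ punchIn (suc zero) (fold i)
  fold-inner i rewrite view-inject₁ i = refl

  opposite-fromℕ : ∀ m → opposite (fromℕ m) ≡ zero
  opposite-fromℕ zero    = refl
  opposite-fromℕ (suc m) = cong inject₁ (opposite-fromℕ m)

  opposite-inject₁ : (i : Fin m) → opposite (inject₁ i) ≡ suc (opposite i)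
  opposite-inject₁ zero    = refl
  opposite-inject₁ (suc i) = cong inject₁ (opposite-inject₁ i)

  fold-opposite : (i : Fin m) → fold (opposite i) ≡ fold i
  fold-opposite {suc zero}    zero = refl
  fold-opposite {suc (suc m)} zero = fold-last m
  fold-opposite {suc (suc m)} (suc i) with view i
  ... | ‵fromℕ     = cong (fold ∘ inject₁) (opposite-fromℕ m)
  ... | ‵inject₁ i = begin
    fold (inject₁ (opposite (inject₁ i))) ≡⟨ cong (fold ∘ inject₁) (opposite-inject₁ i) ⟩
    fold (suc (inject₁ (opposite i)))     ≡⟨ fold-inner (opposite i) ⟩
    punchIn (suc zero) (fold (opposite i)) ≡⟨ cong (punchIn (suc zero)) (fold-opposite i) ⟩
    punchIn (suc zero) (fold i)           ∎
    where open ≡-Reasoning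

  Symmetric : Vector ℕ m → Set
  Symmetric h = ∀ i → h (opposite i) ≡ h i

  inner : Vector ℕ (suc (suc m)) → Vector ℕ m
  inner h i = h (suc (inject₁ i))

  -- A missing centre gets the value 0.
  onOrbits : Vector ℕ m → Vector ℕ (suc ⌊ m /2⌋)
  onOrbits {zero}        h zero          = 0
  onOrbits {suc zero}    h zero          = h zero
  onOrbits {suc (suc m)} h zero          = onOrbits (inner h) zero
  onOrbits {suc (suc m)} h (suc zero)    = h zero
  onOrbits {suc (suc m)} h (suc (suc k)) = onOrbits (inner h) (suc k)

  -- `onOrbits` reads `h` only at the centre and at the first index of each pair; symmetry recovers
  -- the second index.
  onOrbits-fold : (h : Vector ℕ m) → Symmetric h → ∀ i → onOrbits h (fold i) ≡ h i
  onOrbits-fold {suc zero}    h h-sym zero = refl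
  onOrbits-fold {suc (suc m)} h h-sym zero = refl
  onOrbits-fold {suc (suc m)} h h-sym (suc i) with view i
  ... | ‵fromℕ     = sym (h-sym zero)
  ... | ‵inject₁ i = trans (onOrbits-punchIn (fold i)) (onOrbits-fold (inner h) inner-sym i)
    where
    onOrbits-punchIn : ∀ k → onOrbits h (punchIn (suc zero) k) ≡ onOrbits (inner h) k
    onOrbits-punchIn zero    = refl
    onOrbits-punchIn (suc k) = refl

    inner-sym : Symmetric (inner h)
    inner-sym j = trans (cong (h ∘ inject₁) (sym (opposite-inject₁ j))) (h-sym (suc (inject₁ j)))

  -- The weights 1 and 2 are the orbit sizes. A missing centre causes no error as long as its value
  -- is 0.
  orbitSum : Vector ℕ (suc n) → ℕ
  orbitSum h = h zero + sum (h ∘ suc) * 2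

  orbitSum-cong : {g h : Vector ℕ (suc n)} → (∀ k → g k ≡ h k) → orbitSum g ≡ orbitSum h
  orbitSum-cong g≗h = cong₂ _+_ (g≗h zero) (cong (_* 2) (sum-cong-≗ (g≗h ∘ suc)))

  -- The bound by g forces h zero ≡ 0 if the centre is missing.
  sum-fold : (h : Vector ℕ (suc ⌊ m /2⌋)) (g : Vector ℕ m) → h zero ≤ onOrbits g zero →
    sum {m} (h ∘ fold) ≡ orbitSum h
  sum-fold {zero}        h g h₀≤0 = sym (trans (+-identityʳ (h zero)) (n≤0⇒n≡0 h₀≤0))
  sum-fold {suc zero}    h g _    = refl
  sum-fold {suc (suc m)} h g h₀≤  = begin
    h₁ + sum (λ i → h (fold (suc i)))
      ≡⟨ cong (h₁ +_) (sum-init-last {m} (λ i → h (fold (suc i)))) ⟩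
    h₁ + (sum (λ i → h (fold (suc (inject₁ i)))) + h (fold (suc (fromℕ m))))
      ≡⟨ cong (h₁ +_) (cong₂ _+_ (sum-cong-≗ (cong h ∘ fold-inner)) (cong h (fold-last m))) ⟩
    h₁ + (sum {m} (h ∘ punchIn (suc zero) ∘ fold) + h₁)
      ≡⟨ cong (λ x → h₁ + (x + h₁)) (sum-fold (h ∘ punchIn (suc zero)) (inner g) h₀≤) ⟩
    h₁ + (orbitSum (h ∘ punchIn (suc zero)) + h₁)
      ≡⟨ rearranged h₁ (h zero) _ ⟩
    orbitSum h ∎
    where
    open ≡-Reasoning
    h₁ = h (suc zero)
    rearranged : ∀ x y z → x + (y + z * 2 + x) ≡ y + (x + z) * 2
    rearranged = solve-∀

  sum-orbits : (h : Vector ℕ m) → Symmetric h → sum h ≡ orbitSum (onOrbits h)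
  sum-orbits h h-sym =
    trans (sym (sum-cong-≗ (onOrbits-fold h h-sym))) (sum-fold (onOrbits h) h ≤-refl)

  -- Peeling off the outer columns in pairs ends at the central column, whose sum is given, or at no
  -- column, where both sides are 0 by the default value in `onOrbits`.
  onOrbits-sum : (a : Fin m → Vector ℕ n) (s : Vector ℕ n) → (∀ j → sum (flip a j) ≡ s j) →
    sum (λ i → onOrbits (a i) zero) ≡ onOrbits s zero
  onOrbits-sum {m} {zero}        a s columns = sum-replicate-zero m
  onOrbits-sum {m} {suc zero}    a s columns = columns zero
  onOrbits-sum {m} {suc (suc n)} a s columns = onOrbits-sum (inner ∘ a) (inner s)
    (λ j → columns (suc (inject₁ j)))

  -- In a row symmetric about the central column, all entries but the
  -- central one pair up, so the central one has the parity of the row sum.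
  parity-bound : (a : Fin m → Vector ℕ n) (r : Vector ℕ m) (s : Vector ℕ n) →
    (∀ i → Symmetric (a i)) → Symmetric r →
    (∀ i → sum (a i) ≡ r i) → (∀ j → sum (flip a j) ≡ s j) →
    orbitSum (λ k → onOrbits r k % 2) ≤ onOrbits s zero
  parity-bound {m} a r s a-sym r-sym rows columns = begin
    orbitSum (λ k → onOrbits r k % 2)
      ≡⟨ sum-fold (λ k → onOrbits r k % 2) r (m%n≤m (onOrbits r zero) 2) ⟨
    sum {m} (λ i → onOrbits r (fold i) % 2)
      ≡⟨ sum-cong-≗ (λ i → cong (_% 2) (onOrbits-fold r r-sym i)) ⟩
    sum (λ i → r i % 2)
      ≤⟨ sum-mono centre ⟩
    sum (λ i → onOrbits (a i) zero)
      ≡⟨ onOrbits-sum a s columns ⟩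
    onOrbits s zero ∎
    where
    open ≤-Reasoning
    centre : ∀ i → r i % 2 ≤ onOrbits (a i) zero
    centre i = begin
      r i % 2                       ≡⟨ cong (_% 2) (rows i) ⟨
      sum (a i) % 2                 ≡⟨ cong (_% 2) (sum-orbits (a i) (a-sym i)) ⟩
      orbitSum (onOrbits (a i)) % 2 ≡⟨ [m+kn]%n≡m%n (onOrbits (a i) zero) (sum (onOrbits (a i) ∘ suc)) 2 ⟩
      onOrbits (a i) zero % 2       ≤⟨ m%n≤m _ 2 ⟩
      onOrbits (a i) zero           ∎

  -- Transportation matrices on orbits.

  bordered : ℕ → Vector ℕ m → Vector ℕ n → (Fin (suc m) → Fin (suc n) → ℕ) →
    Fin (suc m) → Fin (suc n) → ℕ
  bordered c a b Z zero    zero    = c + Z zero zero * 4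
  bordered c a b Z zero    (suc j) = b j + Z zero (suc j) * 2
  bordered c a b Z (suc i) zero    = a i + Z (suc i) zero * 2
  bordered c a b Z (suc i) (suc j) = Z (suc i) (suc j)

  -- Transposition exchanges the borders `a` and `b`, so results on the rows of `bordered` also
  -- serve for its columns.
  bordered-flip : ∀ c (a : Vector ℕ m) (b : Vector ℕ n) Z i j →
    bordered c a b Z i j ≡ bordered c b a (flip Z) j i
  bordered-flip c a b Z zero    zero    = refl
  bordered-flip c a b Z zero    (suc j) = refl
  bordered-flip c a b Z (suc i) zero    = refl
  bordered-flip c a b Z (suc i) (suc j) = refl

  -- The factors 4, 2 and 1 of `Z` in `bordered` even out the orbit weights: in an orbit sum, all of
  -- the central row of `Z` counts with weight 4, and all of any other row with weight 2. The terms
  -- `c`, `a` and `b` leave room for the parities.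
  bordered-row₀ : ∀ c (a : Vector ℕ m) (b : Vector ℕ n) Z →
    orbitSum (bordered c a b Z zero) ≡ c + (sum b + sum (Z zero) * 2) * 2
  bordered-row₀ c a b Z = begin
    c + z * 4 + sum (λ j → b j + zs j * 2) * 2
      ≡⟨ cong (λ x → c + z * 4 + x * 2) (∑-distrib-+ b (λ j → zs j * 2)) ⟩
    c + z * 4 + (sum b + sum (λ j → zs j * 2)) * 2
      ≡⟨ cong (λ x → c + z * 4 + (sum b + x) * 2) (*-distribʳ-sum 2 zs) ⟨
    c + z * 4 + (sum b + sum zs * 2) * 2
      ≡⟨ rearranged c z (sum b) (sum zs) ⟩
    c + (sum b + (z + sum zs) * 2) * 2 ∎
    where
    open ≡-Reasoning
    z  = Z zero zero
    zs = λ j → Z zero (suc j)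
    rearranged : ∀ c z b s → c + z * 4 + (b + s * 2) * 2 ≡ c + (b + (z + s) * 2) * 2
    rearranged = solve-∀

  bordered-row : ∀ c (a : Vector ℕ m) (b : Vector ℕ n) Z i →
    orbitSum (bordered c a b Z (suc i)) ≡ a i + sum (Z (suc i)) * 2
  bordered-row c a b Z i = rearranged (a i) (Z (suc i) zero) _
    where
    rearranged : ∀ a z s → a + z * 2 + s * 2 ≡ a + (z + s) * 2
    rearranged = solve-∀

  %2-cancel : ∀ x h y k → x + h * 2 ≡ y + k * 2 → x % 2 ≡ y % 2
  %2-cancel x h y k eq = begin
    x % 2           ≡⟨ [m+kn]%n≡m%n x h 2 ⟨
    (x + h * 2) % 2 ≡⟨ cong (_% 2) eq ⟩
    (y + k * 2) % 2 ≡⟨ [m+kn]%n≡m%n y k 2 ⟩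
    y % 2           ∎
    where open ≡-Reasoning

  [m+k*2]/2 : ∀ m k → (m + k * 2) / 2 ≡ m / 2 + k
  [m+k*2]/2 m k = trans (+-distrib-/-∣ʳ m (n∣m*n k)) (cong (m / 2 +_) (m*n/n≡m k 2))

  -- As `x` and `y` have the same parity, the bound says that `x` has room for `b * 2` besides its
  -- own parity. The witness `u` is half of what remains.
  excess : ∀ x y b → x % 2 ≡ y % 2 → y % 2 + b * 2 ≤ x → ∃[ u ] x ≡ x % 2 + (b + u) * 2
  excess x y b x≡y bound = x / 2 ∸ b , (begin
    x                              ≡⟨ x≡ ⟩
    x % 2 + x / 2 * 2              ≡⟨ cong (λ y → x % 2 + y * 2) (m+[n∸m]≡n b≤x/2) ⟨
    x % 2 + (b + (x / 2 ∸ b)) * 2  ∎)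
    where
    open ≡-Reasoning
    x≡ = m≡m%n+[m/n]*n x 2
    b≤x/2 : b ≤ x / 2
    b≤x/2 = *-cancelʳ-≤ b (x / 2) 2
      (+-cancelˡ-≤ (x % 2) (b * 2) (x / 2 * 2)
        (subst₂ (λ e x → e + b * 2 ≤ x) (sym x≡y) x≡ bound))

  -- Arranged for cancellation: when `b` is the sum of the non-central parities of the other family
  -- of marginals, the part before `u` is the same for rows and columns. Equal totals then yield an
  -- equation between the two terms that start with `u`.
  orbitSum-halves : ∀ b u (r : Vector ℕ (suc m)) → r zero ≡ r zero % 2 + (b + u) * 2 →
    orbitSum r ≡ r zero % 2 +
      (sum (λ i → r (suc i) % 2) + b + (u + sum (λ i → r (suc i) / 2) * 2)) * 2
  orbitSum-halves b u r r₀≡ = begin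
    r zero + sum r′ * 2
      ≡⟨ cong₂ (λ x y → x + y * 2) r₀≡ (begin
        sum r′                                  ≡⟨ sum-cong-≗ (λ i → m≡m%n+[m/n]*n (r′ i) 2) ⟩
        sum (λ i → r′ i % 2 + r′ i / 2 * 2)     ≡⟨ ∑-distrib-+ (λ i → r′ i % 2) _ ⟩
        α + sum (λ i → r′ i / 2 * 2)            ≡⟨ cong (α +_) (*-distribʳ-sum 2 (λ i → r′ i / 2)) ⟨
        α + h * 2                               ∎) ⟩
    r zero % 2 + (b + u) * 2 + (α + h * 2) * 2
      ≡⟨ rearranged (r zero % 2) b u α h ⟩
    r zero % 2 + (α + b + (u + h * 2)) * 2 ∎
    where
    open ≡-Reasoning
    r′ = r ∘ suc
    α  = sum (λ i → r′ i % 2)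
    h  = sum (λ i → r′ i / 2)
    rearranged : ∀ e b u a h → e + (b + u) * 2 + (a + h * 2) * 2 ≡ e + (a + b + (u + h * 2)) * 2
    rearranged = solve-∀

  -- The marginals for `Z`. Without the parities, `u * 2` is left of the central marginal; deducting
  -- `u % 2 * 2` gives a multiple of 4, and division by the weight 4 gives `u / 2`. The other rows
  -- have weight 2.
  halved : ℕ → Vector ℕ (suc m) → Vector ℕ (suc m)
  halved u r zero    = u / 2
  halved u r (suc i) = r (suc i) / 2

  bordered-rows : ∀ (r : Vector ℕ (suc m)) (b : Vector ℕ n) u Z →
    r zero ≡ r zero % 2 + (sum b + u) * 2 → (∀ i → sum (Z i) ≡ halved u r i) →
    ∀ i → orbitSum (bordered (r zero % 2 + u % 2 * 2) (λ i → r (suc i) % 2) b Z i) ≡ r i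
  bordered-rows r b u Z r₀≡ rows zero = begin
    orbitSum (bordered c a b Z zero)       ≡⟨ bordered-row₀ c a b Z ⟩
    c + (sum b + sum (Z zero) * 2) * 2     ≡⟨ cong (λ z → c + (sum b + z * 2) * 2) (rows zero) ⟩
    c + (sum b + u / 2 * 2) * 2            ≡⟨ rearranged (r zero % 2) (u % 2) (sum b) (u / 2 * 2) ⟩
    r zero % 2 + (sum b + (u % 2 + u / 2 * 2)) * 2
      ≡⟨ cong (λ u → r zero % 2 + (sum b + u) * 2) (m≡m%n+[m/n]*n u 2) ⟨
    r zero % 2 + (sum b + u) * 2           ≡⟨ r₀≡ ⟨
    r zero                                 ∎
    where
    open ≡-Reasoning
    a = λ i → r (suc i) % 2
    c = r zero % 2 + u % 2 * 2
    rearranged : ∀ e d b h → e + d * 2 + (b + h) * 2 ≡ e + (b + (d + h)) * 2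
    rearranged = solve-∀
  bordered-rows r b u Z r₀≡ rows (suc i) = begin
    orbitSum (bordered c a b Z (suc i))        ≡⟨ bordered-row c a b Z i ⟩
    r (suc i) % 2 + sum (Z (suc i)) * 2        ≡⟨ cong (λ z → r (suc i) % 2 + z * 2) (rows (suc i)) ⟩
    r (suc i) % 2 + r (suc i) / 2 * 2          ≡⟨ m≡m%n+[m/n]*n (r (suc i)) 2 ⟨
    r (suc i)                                  ∎
    where
    open ≡-Reasoning
    a = λ i → r (suc i) % 2
    c = r zero % 2 + u % 2 * 2

  -- Subtracting the parities of the marginals, placed in the central row and
  -- column, leaves central marginals 2u and 2v with u ≡ v mod 2; subtracting
  -- 2 (u % 2) at the centre leaves marginals that can be halved, and these
  -- halves are the marginals of a transportation matrix.
  orbit-transport : (r : Vector ℕ (suc m)) (s : Vector ℕ (suc n)) →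
    orbitSum r ≡ orbitSum s →
    orbitSum (λ k → r k % 2) ≤ s zero → orbitSum (λ k → s k % 2) ≤ r zero →
    ∃[ C ] ((∀ i → orbitSum (C i) ≡ r i) × (∀ j → orbitSum (flip C j) ≡ s j))
  orbit-transport {m} {n} r s r≡s par-r par-s =
    C , bordered-rows r b u Z r₀≡ rows , λ j → begin
      orbitSum (flip C j)
        ≡⟨ orbitSum-cong (λ i → bordered-flip (r zero % 2 + u % 2 * 2) a b Z i j) ⟩
      orbitSum (bordered (r zero % 2 + u % 2 * 2) b a (flip Z) j)
        -- The central entry was built from row data. The column data prescribe the same value,
        -- since the central marginals agree in parity and so do `u` and `v`.
        ≡⟨ cong (λ c → orbitSum (bordered c b a (flip Z) j)) (cong₂ (λ e d → e + d * 2) ε≡ δ≡) ⟩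
      orbitSum (bordered (s zero % 2 + v % 2 * 2) b a (flip Z) j)
        ≡⟨ bordered-rows s a v (flip Z) s₀≡ columns j ⟩
      s j ∎
    where
    open ≡-Reasoning
    a = λ i → r (suc i) % 2
    b = λ j → s (suc j) % 2
    h = sum (λ i → r (suc i) / 2)
    k = sum (λ j → s (suc j) / 2)

    ε≡ : r zero % 2 ≡ s zero % 2
    ε≡ = %2-cancel (r zero) (sum (r ∘ suc)) (s zero) (sum (s ∘ suc)) r≡s

    -- The non-central column parities `b` are placed in the central row, so it is the parity
    -- condition on `s` that bounds `r zero`; likewise with the roles exchanged.
    excess-r = excess (r zero) (s zero) (sum b) ε≡ par-s
    excess-s = excess (s zero) (r zero) (sum a) (sym ε≡) par-r
    u   = proj₁ excess-r
    v   = proj₁ excess-s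
    r₀≡ = proj₂ excess-r
    s₀≡ = proj₂ excess-s

    u+h≡v+k : u + h * 2 ≡ v + k * 2
    u+h≡v+k = +-cancelˡ-≡ (sum a + sum b) _ _ (*-cancelʳ-≡ _ _ 2 (+-cancelˡ-≡ (r zero % 2) _ _ (begin
      r zero % 2 + (sum a + sum b + (u + h * 2)) * 2 ≡⟨ orbitSum-halves (sum b) u r r₀≡ ⟨
      orbitSum r                                     ≡⟨ r≡s ⟩
      orbitSum s                                     ≡⟨ orbitSum-halves (sum a) v s s₀≡ ⟩
      s zero % 2 + (sum b + sum a + (v + k * 2)) * 2
        ≡⟨ cong₂ (λ e x → e + (x + (v + k * 2)) * 2) (sym ε≡) (+-comm (sum b) (sum a)) ⟩
      r zero % 2 + (sum a + sum b + (v + k * 2)) * 2 ∎)))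

    δ≡ : u % 2 ≡ v % 2
    δ≡ = %2-cancel u h v k u+h≡v+k

    transported = transport (halved u r) (halved v s) (begin
      u / 2 + h       ≡⟨ [m+k*2]/2 u h ⟨
      (u + h * 2) / 2 ≡⟨ cong (_/ 2) u+h≡v+k ⟩
      (v + k * 2) / 2 ≡⟨ [m+k*2]/2 v k ⟩
      v / 2 + k       ∎)
    Z       = proj₁ transported
    rows    = proj₁ (proj₂ transported)
    columns = proj₂ (proj₂ transported)

    C : Fin (suc m) → Fin (suc n) → ℕ
    C = bordered (r zero % 2 + u % 2 * 2) a b Z

  -- From orbit matrices back to symmetric matrices.

  symmetric-sum : (a : Fin m → Vector ℕ n) (r : Vector ℕ m) → (∀ j → Symmetric (flip a j)) →
    (∀ i → sum (a i) ≡ r i) → Symmetric r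
  symmetric-sum a r a-sym rows i =
    trans (sym (rows (opposite i))) (trans (sum-cong-≗ (λ j → a-sym j i)) (rows i))

  -- This supplies the bound required by `sum-fold`: an entry in the central column of an orbit
  -- matrix is at most the marginal of that column, which is 0 if there is no centre.
  term≤orbitSum : (h : Vector ℕ (suc n)) → ∀ k → h k ≤ orbitSum h
  term≤orbitSum h zero    = m≤m+n (h zero) _
  term≤orbitSum h (suc k) = begin
    h (suc k)           ≤⟨ term≤sum (h ∘ suc) k ⟩
    sum (h ∘ suc)       ≤⟨ m≤m*n _ 2 ⟩
    sum (h ∘ suc) * 2   ≤⟨ m≤n+m _ (h zero) ⟩
    orbitSum h          ∎
    where open ≤-Reasoning

  -- Composing an orbit matrix with `fold` in both indices makes it symmetric both ways. Here `a`
  -- supplies the symmetry of `s` and the bound on the parities of `r`, and `b` the reverse.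
  symmetric-transport : (r : Vector ℕ m) (s : Vector ℕ n) (a b : Fin m → Vector ℕ n) →
    (∀ i → Symmetric (a i)) → (∀ i → sum (a i) ≡ r i) → (∀ j → sum (flip a j) ≡ s j) →
    (∀ j → Symmetric (flip b j)) → (∀ i → sum (b i) ≡ r i) → (∀ j → sum (flip b j) ≡ s j) →
    Σ[ c ∈ (Fin m → Vector ℕ n) ]
      ((∀ i → Symmetric (c i)) × (∀ j → Symmetric (flip c j)) ×
       (∀ i → sum (c i) ≡ r i) × (∀ j → sum (flip c j) ≡ s j))
  symmetric-transport {m} {n} r s a b a-sym a-rows a-columns b-sym b-rows b-columns =
    (λ i j → C (fold i) (fold j)) ,
    (λ i j → cong (C (fold i)) (fold-opposite j)) ,
    (λ j i → cong (λ k → C k (fold j)) (fold-opposite i)) ,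
    (λ i → begin
      sum {n} (C (fold i) ∘ fold) ≡⟨ sum-fold (C (fold i)) s (subst (C (fold i) zero ≤_)
                                       (C-columns zero) (term≤orbitSum (flip C zero) (fold i))) ⟩
      orbitSum (C (fold i))       ≡⟨ C-rows (fold i) ⟩
      onOrbits r (fold i)         ≡⟨ onOrbits-fold r r-sym i ⟩
      r i                         ∎) ,
    (λ j → begin
      sum {m} (flip C (fold j) ∘ fold) ≡⟨ sum-fold (flip C (fold j)) r (subst (C zero (fold j) ≤_)
                                            (C-rows zero) (term≤orbitSum (C zero) (fold j))) ⟩
      orbitSum (flip C (fold j))       ≡⟨ C-columns (fold j) ⟩
      onOrbits s (fold j)              ≡⟨ onOrbits-fold s s-sym j ⟩
      s j                              ∎)
    where
    open ≡-Reasoning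

    r-sym : Symmetric r
    r-sym = symmetric-sum b r b-sym b-rows

    s-sym : Symmetric s
    s-sym = symmetric-sum (flip a) s a-sym a-columns

    C-properties = orbit-transport (onOrbits r) (onOrbits s)
      (begin
        orbitSum (onOrbits r)     ≡⟨ sum-orbits r r-sym ⟨
        sum r                     ≡⟨ sum-cong-≗ a-rows ⟨
        sum (λ i → sum (a i))     ≡⟨ ∑-comm a ⟩
        sum (λ j → sum (flip a j)) ≡⟨ sum-cong-≗ a-columns ⟩
        sum s                     ≡⟨ sum-orbits s s-sym ⟩
        orbitSum (onOrbits s)     ∎)
      (parity-bound a r s a-sym r-sym a-rows a-columns)
      (parity-bound (flip b) s r b-sym s-sym b-columns b-rows)
    C         = proj₁ C-properties
    C-rows    = proj₁ (proj₂ C-properties)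
    C-columns = proj₂ (proj₂ C-properties)

open import Defs

open import Algebra.Bundles using (CommutativeMonoid)
import Algebra.Properties.CommutativeMonoid.Sum as CommutativeMonoidSum
open import Data.Fin.Base using (Fin; zero; suc; opposite)
import Data.Fin.Permutation as Permutation
open import Data.Fin.Properties using (opposite-involutive)
open import Data.Integer.Base as ℤ using (+_; -[1+_])
import Data.Integer.Properties as ℤ
open import Data.Nat.Base as ℕ using (ℕ; zero; suc; NonZero)
import Data.Nat.Properties as ℕ
open import Data.Product.Base using (∃-syntax; _×_; _,_; proj₁; proj₂)
open import Data.Rational.Base as ℚ using (ℚ; 0ℚ; 1ℚ; ½; ∣_∣; toℚᵘ)
import Data.Rational.Properties as ℚ
import Data.Rational.Unnormalised.Base as ℚᵘ
import Data.Rational.Unnormalised.Properties as ℚᵘ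
open import Data.Rational.Solver using (module +-*-Solver)
open import Data.Sum.Base using (inj₁; inj₂)
open import Data.Vec.Functional using (Vector)
open import Function.Bundles using (_⇔_; mk⇔)
import Relation.Binary.Reasoning.Setoid as ≃-Reasoning
open import Level using (0ℓ)
open import Relation.Binary.PropositionalEquality
  using (_≡_; refl; sym; trans; cong; cong₂; subst)
open import Relation.Nullary.Decidable.Core using (decidable-stable)
open import Relation.Nullary.Negation.Core using (contradiction)
open import Relation.Unary using (Satisfiable; _∈_)

open +-*-Solver using (solve; _:=_; _:+_; _:-_; _:*_; :-_; con)
open NaturalMatrices using (symmetric-transport) renaming (sum to ℕ-sum)


-- Null sequences and the additive monoid of reals.

IsNull : (ℕ → ℚ) → Set
IsNull d = ∀ ε → 0ℚ ℚ.< ε → ∃[ N ] (∀ n → N ℕ.≤ n → ∣ d n ∣ ℚ.< ε)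

halves : ∀ ε → ½ ℚ.* ε ℚ.+ ½ ℚ.* ε ≡ ε
halves = solve 1 (λ ε → con ½ :* ε :+ con ½ :* ε := ε) refl

½-positive : ∀ {ε} → 0ℚ ℚ.< ε → 0ℚ ℚ.< ½ ℚ.* ε
½-positive = ℚ.*-monoʳ-<-pos ½

-- `x ≃ y` unfolds to `IsNull` of the termwise difference, so closure properties of null sequences
-- apply directly to `_≃_`.
null-≤ : ∀ {c d} → IsNull d → (∀ n → ∣ c n ∣ ℚ.≤ ∣ d n ∣) → IsNull c
null-≤ d-null c≤d ε 0<ε with d-null ε 0<ε
... | N , hd = N , λ n N≤n → ℚ.≤-<-trans (c≤d n) (hd n N≤n)

null-+ : ∀ {c d} → IsNull c → IsNull d → IsNull (λ n → c n ℚ.+ d n)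
null-+ {c} {d} c-null d-null ε 0<ε
  with c-null (½ ℚ.* ε) (½-positive 0<ε) | d-null (½ ℚ.* ε) (½-positive 0<ε)
... | M , hc | N , hd = M ℕ.⊔ N , λ n p → begin-strict
  ∣ c n ℚ.+ d n ∣        ≤⟨ ℚ.∣p+q∣≤∣p∣+∣q∣ (c n) (d n) ⟩
  ∣ c n ∣ ℚ.+ ∣ d n ∣     <⟨ ℚ.+-mono-< (hc n (ℕ.m⊔n≤o⇒m≤o M N p)) (hd n (ℕ.m⊔n≤o⇒n≤o M N p)) ⟩
  ½ ℚ.* ε ℚ.+ ½ ℚ.* ε    ≡⟨ halves ε ⟩
  ε                      ∎
  where open ℚ.≤-Reasoning

null-≡ : ∀ {c d} → IsNull d → (∀ n → c n ≡ d n) → IsNull c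
null-≡ d-null c≡d = null-≤ d-null (λ n → ℚ.≤-reflexive (cong ∣_∣ (c≡d n)))

≗⇒≃ : ∀ x y → (∀ n → seq x n ≡ seq y n) → x ≃ y
≗⇒≃ x y x≗y ε 0<ε = 0 , λ n _ → subst (ℚ._< ε)
  (sym (cong ∣_∣ (trans (cong (ℚ._- seq y n) (x≗y n)) (ℚ.+-inverseʳ (seq y n))))) 0<ε

≃-refl : ∀ {x} → x ≃ x
≃-refl {x} = ≗⇒≃ x x (λ _ → refl)

≃-sym : ∀ {x y} → x ≃ y → y ≃ x
≃-sym {x} {y} x≃y = null-≤ x≃y λ n → ℚ.≤-reflexive
  (trans (cong ∣_∣ (flipped (seq x n) (seq y n))) (ℚ.∣-p∣≡∣p∣ (seq x n ℚ.- seq y n)))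
  where
  flipped : ∀ p q → q ℚ.- p ≡ ℚ.- (p ℚ.- q)
  flipped = solve 2 (λ p q → q :- p := :- (p :- q)) refl

≃-trans : ∀ {x y z} → x ≃ y → y ≃ z → x ≃ z
≃-trans {x} {y} {z} x≃y y≃z =
  null-≡ (null-+ x≃y y≃z) λ n → telescoped (seq x n) (seq y n) (seq z n)
  where
  telescoped : ∀ p q r → p ℚ.- r ≡ (p ℚ.- q) ℚ.+ (q ℚ.- r)
  telescoped = solve 3 (λ p q r → p :- r := (p :- q) :+ (q :- r)) refl

+-cong : ∀ {x x′ y y′} → x ≃ x′ → y ≃ y′ → x + y ≃ x′ + y′
+-cong {x} {x′} {y} {y′} x≃x′ y≃y′ = null-≡ (null-+ x≃x′ y≃y′) λ n →
  interchanged (seq x n) (seq x′ n) (seq y n) (seq y′ n)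
  where
  interchanged : ∀ p p′ q q′ → (p ℚ.+ q) ℚ.- (p′ ℚ.+ q′) ≡ (p ℚ.- p′) ℚ.+ (q ℚ.- q′)
  interchanged = solve 4 (λ p p′ q q′ → (p :+ q) :- (p′ :+ q′) := (p :- p′) :+ (q :- q′)) refl

+-0-commutativeMonoid : CommutativeMonoid 0ℓ 0ℓ
+-0-commutativeMonoid = record
  { Carrier = ℝ
  ; _≈_ = _≃_
  ; _∙_ = _+_
  ; ε   = 0ℝ
  ; isCommutativeMonoid = record
    { isMonoid = record
      { isSemigroup = record
        { isMagma = record
          { isEquivalence = record
            { refl  = λ {x} → ≃-refl {x}
            ; sym   = λ {x y} → ≃-sym {x} {y}
            ; trans = λ {x y z} → ≃-trans {x} {y} {z}
            }
          ; ∙-cong = λ {x y u v} → +-cong {x} {y} {u} {v}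
          }
        ; assoc = λ x y z → ≗⇒≃ ((x + y) + z) (x + (y + z))
            λ n → ℚ.+-assoc (seq x n) (seq y n) (seq z n)
        }
      ; identity = (λ x → ≗⇒≃ (0ℝ + x) x λ n → ℚ.+-identityˡ (seq x n))
                 , (λ x → ≗⇒≃ (x + 0ℝ) x λ n → ℚ.+-identityʳ (seq x n))
      }
    ; comm = λ x y → ≗⇒≃ (x + y) (y + x) λ n → ℚ.+-comm (seq x n) (seq y n)
    }
  }

-- Halving of reals.

∣½p∣≤∣p∣ : ∀ p → ∣ ½ ℚ.* p ∣ ℚ.≤ ∣ p ∣
∣½p∣≤∣p∣ p = begin
  ∣ ½ ℚ.* p ∣               ≡⟨ ℚ.∣p*q∣≡∣p∣*∣q∣ ½ p ⟩
  ½ ℚ.* ∣ p ∣               ≡⟨ ℚ.+-identityʳ (½ ℚ.* ∣ p ∣) ⟨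
  ½ ℚ.* ∣ p ∣ ℚ.+ 0ℚ        ≤⟨ ℚ.+-monoʳ-≤ (½ ℚ.* ∣ p ∣) (ℚ.*-monoˡ-≤-nonNeg ½ (ℚ.0≤∣p∣ p)) ⟩
  ½ ℚ.* ∣ p ∣ ℚ.+ ½ ℚ.* ∣ p ∣ ≡⟨ halves ∣ p ∣ ⟩
  ∣ p ∣                     ∎
  where open ℚ.≤-Reasoning

½-distribˡ-minus : ∀ p q → ½ ℚ.* p ℚ.- ½ ℚ.* q ≡ ½ ℚ.* (p ℚ.- q)
½-distribˡ-minus = solve 2 (λ p q → con ½ :* p :- con ½ :* q := con ½ :* (p :- q)) refl

half : ℝ → ℝ
-- Halving shrinks differences, so the index `N` found for `x` and `ε` serves unchanged.
half x = mkℝ (λ n → ½ ℚ.* seq x n) λ ε 0<ε → let N , hx = cauchy x ε 0<ε in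
  N , λ m n N≤m N≤n → ℚ.≤-<-trans
    (subst (ℚ._≤ ∣ seq x m ℚ.- seq x n ∣) (cong ∣_∣ (sym (½-distribˡ-minus (seq x m) (seq x n))))
      (∣½p∣≤∣p∣ (seq x m ℚ.- seq x n)))
    (hx m n N≤m N≤n)

half-cong : ∀ {x y} → x ≃ y → half x ≃ half y
half-cong {x} {y} x≃y = null-≡ (null-≤ x≃y (λ n → ∣½p∣≤∣p∣ (seq x n ℚ.- seq y n)))
  λ n → ½-distribˡ-minus (seq x n) (seq y n)

half-double : ∀ x → half (x + x) ≃ x
half-double x = ≗⇒≃ (half (x + x)) x λ n →
  trans (ℚ.*-distribˡ-+ ½ (seq x n) (seq x n)) (halves (seq x n))

sum-half : ∀ {n} (x : Vector ℝ n) k → seq (sum (λ i → half (x i))) k ≡ ½ ℚ.* seq (sum x) k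
sum-half {zero}  x k = refl
sum-half {suc n} x k = trans (cong (½ ℚ.* seq (x zero) k ℚ.+_) (sum-half (λ i → x (suc i)) k))
  (sym (ℚ.*-distribˡ-+ ½ (seq (x zero) k) (seq (sum (λ i → x (suc i))) k)))

-- The average of two terms with slack `ε` each has slack exactly `ε`, so the tolerance is not
-- split.
half-nonNegative : ∀ x y → 0ℝ ≤ x → 0ℝ ≤ y → 0ℝ ≤ half (x + y)
half-nonNegative x y 0≤x 0≤y ε 0<ε with 0≤x ε 0<ε | 0≤y ε 0<ε
... | M , hx | N , hy = M ℕ.⊔ N , λ n p → subst (0ℚ ℚ.<_)
  (averaged (seq x n) (seq y n) ε)
  (½-positive (ℚ.+-mono-< (hx n (ℕ.m⊔n≤o⇒m≤o M N p)) (hy n (ℕ.m⊔n≤o⇒n≤o M N p))))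
  where
  averaged : ∀ p q ε → ½ ℚ.* ((p ℚ.+ ε) ℚ.+ (q ℚ.+ ε)) ≡ ½ ℚ.* (p ℚ.+ q) ℚ.+ ε
  averaged = solve 3 (λ p q ε → con ½ :* ((p :+ ε) :+ (q :+ ε)) := con ½ :* (p :+ q) :+ ε) refl

-- Rationals, integers and natural numbers as reals.

fromℚ-injective : ∀ {p q} → fromℚ p ≃ fromℚ q → p ≡ q
fromℚ-injective {p} {q} p≃q = decidable-stable (p ℚ.≟ q) λ p≢q →
  -- For constant sequences the tolerance `∣ p ℚ.- q ∣` would have to exceed itself.
  let N , h = p≃q ∣ p ℚ.- q ∣ (ℚ.≰⇒> λ ∣p-q∣≤0 → p≢q (p-q≡0⇒p≡q
                (ℚ.∣p∣≡0⇒p≡0 (p ℚ.- q) (ℚ.≤-antisym ∣p-q∣≤0 (ℚ.0≤∣p∣ (p ℚ.- q))))))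
  in ℚ.<-irrefl refl (h N ℕ.≤-refl)
  where
  p-q≡0⇒p≡q : p ℚ.- q ≡ 0ℚ → p ≡ q
  p-q≡0⇒p≡q eq = trans (sym (cancelled p q)) (trans (cong (ℚ._+ q) eq) (ℚ.+-identityˡ q))
    where
    cancelled : ∀ p q → p ℚ.- q ℚ.+ q ≡ p
    cancelled = solve 2 (λ p q → p :- q :+ q := p) refl

fromℕ : ℕ → ℝ
fromℕ k = fromℤ (+ k)

-- `k ℚ./ 1` does not reduce for a variable `k`; its unnormalised counterpart has an explicit
-- numerator and denominator, so sums are computed there.
toℚᵘ-/1 : ∀ k → toℚᵘ (k ℚ./ 1) ℚᵘ.≃ ℚᵘ.mkℚᵘ k 0
toℚᵘ-/1 k = ℚ.toℚᵘ-fromℚᵘ (ℚᵘ.mkℚᵘ k 0)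

/1-injective : ∀ {k l} → k ℚ./ 1 ≡ l ℚ./ 1 → k ≡ l
/1-injective {k} {l} eq with ℚ.fromℚᵘ-injective {ℚᵘ.mkℚᵘ k 0} {ℚᵘ.mkℚᵘ l 0} eq
... | ℚᵘ.*≡* k*1≡l*1 = trans (sym (ℤ.*-identityʳ k)) (trans k*1≡l*1 (ℤ.*-identityʳ l))

/1-homo-+ : ∀ k l → (k ℤ.+ l) ℚ./ 1 ≡ (k ℚ./ 1) ℚ.+ (l ℚ./ 1)
/1-homo-+ k l = ℚ.toℚᵘ-injective (begin
  toℚᵘ ((k ℤ.+ l) ℚ./ 1)                    ≈⟨ toℚᵘ-/1 (k ℤ.+ l) ⟩
  ℚᵘ.mkℚᵘ (k ℤ.+ l) 0
    ≡⟨ cong (λ z → ℚᵘ.mkℚᵘ z 0) (cong₂ ℤ._+_ (ℤ.*-identityʳ k) (ℤ.*-identityʳ l)) ⟨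
  ℚᵘ.mkℚᵘ k 0 ℚᵘ.+ ℚᵘ.mkℚᵘ l 0              ≈⟨ ℚᵘ.+-cong (toℚᵘ-/1 k) (toℚᵘ-/1 l) ⟨
  toℚᵘ (k ℚ./ 1) ℚᵘ.+ toℚᵘ (l ℚ./ 1)        ≈⟨ ℚ.toℚᵘ-homo-+ (k ℚ./ 1) (l ℚ./ 1) ⟨
  toℚᵘ ((k ℚ./ 1) ℚ.+ (l ℚ./ 1))            ∎)
  where open import Relation.Binary.Reasoning.Setoid ℚᵘ.≃-setoid

fromℕ-injective : ∀ k l → fromℕ k ≃ fromℕ l → k ≡ l
fromℕ-injective k l k≃l = ℤ.+-injective (/1-injective (fromℚ-injective k≃l))

0≤k/1 : ∀ k → 0ℚ ℚ.≤ + k ℚ./ 1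
0≤k/1 k = ℚ.nonNegative⁻¹ (+ k ℚ./ 1) {{ℚ.normalize-nonNeg k 1}}

0≤fromℕ : ∀ k → 0ℝ ≤ fromℕ k
0≤fromℕ k ε 0<ε = 0 , λ _ _ → ℚ.+-mono-≤-< (0≤k/1 k) 0<ε

p≤∣p∣ : ∀ p → p ℚ.≤ ∣ p ∣
p≤∣p∣ p with ℚ.≤-total 0ℚ p
... | inj₁ 0≤p = ℚ.≤-reflexive (sym (ℚ.0≤p⇒∣p∣≡p 0≤p))
... | inj₂ p≤0 = ℚ.≤-trans p≤0 (ℚ.0≤∣p∣ p)

integer-nonNegative : ∀ x → IsInteger x → 0ℝ ≤ x → ∃[ k ] (x ≃ fromℕ k)
integer-nonNegative x (+ k , x≃k) 0≤x = k , x≃k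
integer-nonNegative x (-[1+ k ] , x≃k) 0≤x
  -- A negative integer `c` is at most -1. Eventually `x` lies above -½ and below `c + ½`; the two
  -- slacks of ½ add up to 1, just enough for the contradiction `0 < c + 1 ≤ 0`.
  with x≃k ½ (ℚ.positive⁻¹ ½) | 0≤x ½ (ℚ.positive⁻¹ ½)
... | M , hk | N , h0 = contradiction (begin-strict
  0ℚ                         <⟨ h0 n (ℕ.m≤n⊔m M N) ⟩
  seq x n ℚ.+ ½              ≡⟨ shifted (seq x n) c ⟩
  (seq x n ℚ.- c) ℚ.+ (c ℚ.+ ½)
    <⟨ ℚ.+-monoˡ-< (c ℚ.+ ½) (ℚ.≤-<-trans (p≤∣p∣ (seq x n ℚ.- c)) (hk n (ℕ.m≤m⊔n M N))) ⟩
  ½ ℚ.+ (c ℚ.+ ½)            ≡⟨ collected c ⟩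
  c ℚ.+ (1ℚ ℚ.+ 0ℚ)          ≤⟨ ℚ.+-monoʳ-≤ c (ℚ.+-monoʳ-≤ 1ℚ (0≤k/1 k)) ⟩
  c ℚ.+ (1ℚ ℚ.+ + k ℚ./ 1)   ≡⟨ cong (c ℚ.+_) (/1-homo-+ (+ 1) (+ k)) ⟨
  c ℚ.+ + suc k ℚ./ 1        ≡⟨ /1-homo-+ -[1+ k ] (+ suc k) ⟨
  (-[1+ k ] ℤ.+ + suc k) ℚ./ 1 ≡⟨ cong (ℚ._/ 1) (ℤ.+-inverseˡ (+ suc k)) ⟩
  0ℚ                         ∎) (ℚ.<-irrefl refl)
  where
  open ℚ.≤-Reasoning
  n = M ℕ.⊔ N
  c = -[1+ k ] ℚ./ 1
  shifted : ∀ p c → p ℚ.+ ½ ≡ (p ℚ.- c) ℚ.+ (c ℚ.+ ½)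
  shifted = solve 2 (λ p c → p :+ con ½ := (p :- c) :+ (c :+ con ½)) refl
  collected : ∀ c → ½ ℚ.+ (c ℚ.+ ½) ≡ c ℚ.+ (1ℚ ℚ.+ 0ℚ)
  collected = solve 1 (λ c → con ½ :+ (c :+ con ½) := c :+ (con 1ℚ :+ con 0ℚ)) refl

-- Finite sums of reals.

open CommutativeMonoid +-0-commutativeMonoid using (setoid)
open CommutativeMonoidSum +-0-commutativeMonoid using (sum-cong-≋; sum-permute; ∑-distrib-+)
open ≃-Reasoning setoid

sum-fromℕ : ∀ {n} (k : Vector ℕ n) → sum (λ i → fromℕ (k i)) ≃ fromℕ (ℕ-sum k)
sum-fromℕ {zero}  k = ≃-refl {0ℝ}
sum-fromℕ {suc n} k = begin
  fromℕ k₀ + sum (λ i → fromℕ (k (suc i)))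
    ≈⟨ +-cong {fromℕ k₀} {fromℕ k₀} {sum (λ i → fromℕ (k (suc i)))} {fromℕ ∑k}
         (≃-refl {fromℕ k₀}) (sum-fromℕ (λ i → k (suc i))) ⟩
  fromℕ k₀ + fromℕ ∑k
    ≈⟨ ≗⇒≃ (fromℕ k₀ + fromℕ ∑k) (fromℕ (k₀ ℕ.+ ∑k)) (λ _ → sym (/1-homo-+ (+ k₀) (+ ∑k))) ⟩
  fromℕ (k₀ ℕ.+ ∑k) ∎
  where
  k₀ = k zero
  ∑k = ℕ-sum (λ i → k (suc i))

-- Used with `z` a prescribed row or column sum, to represent it by a natural number.
sum≃fromℕ : ∀ {n} (x : Vector ℝ n) (k : Vector ℕ n) {z} →
  (∀ i → x i ≃ fromℕ (k i)) → sum x ≃ z → z ≃ fromℕ (ℕ-sum k)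
sum≃fromℕ x k {z} x≃k ∑x≃z = begin
  z                       ≈⟨ ∑x≃z ⟨
  sum x                   ≈⟨ sum-cong-≋ x≃k ⟩
  sum (λ i → fromℕ (k i)) ≈⟨ sum-fromℕ k ⟩
  fromℕ (ℕ-sum k)         ∎

sum-average : ∀ {n} (x y : Vector ℝ n) {z} → sum x ≃ z → sum y ≃ z →
  sum (λ i → half (x i + y i)) ≃ z
sum-average x y {z} ∑x≃z ∑y≃z = begin
  sum (λ i → half (x i + y i))
    ≈⟨ ≗⇒≃ (sum (λ i → half (x i + y i))) (half (sum (λ i → x i + y i))) (sum-half (λ i → x i + y i)) ⟩
  half (sum (λ i → x i + y i))
    ≈⟨ half-cong {sum (λ i → x i + y i)} {sum x + sum y} (∑-distrib-+ x y) ⟩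
  half (sum x + sum y)
    ≈⟨ half-cong {sum x + sum y} {z + z} (+-cong {sum x} {z} {sum y} {z} ∑x≃z ∑y≃z) ⟩
  half (z + z)
    ≈⟨ half-double z ⟩
  z ∎

fromℕ-cong : ∀ k l → k ≡ l → fromℕ k ≃ fromℕ l
fromℕ-cong k l refl = ≃-refl {fromℕ k}

-- `ρπ` is the composite of the two reflections.
fixed-D₊ : ∀ {m n} {A : Matrix m n} → Fixed r∞ A → Fixed r₀ A → ∀ g → Fixed g A
fixed-D₊ {A = A} fix∞ fix₀ ρ₀ i j = ≃-refl {A i j}
fixed-D₊ {A = A} fix∞ fix₀ ρπ i j = begin
  A (opposite i) (opposite j) ≈⟨ fix₀ i (opposite j) ⟩
  A i (opposite j)            ≈⟨ fix∞ i j ⟩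
  A i j                       ∎
fixed-D₊ fix∞ fix₀ r₀ = fix₀
fixed-D₊ fix∞ fix₀ r∞ = fix∞

-- Real matrices: averaging over `r₀`.

module _ {m n : ℕ} (R : Vector ℝ m) (S : Vector ℝ n) where

  rowSums-symmetric : ∀ {B} → B ∈ 𝒯 R S → Fixed r₀ B → ∀ i → R (opposite i) ≃ R i
  rowSums-symmetric {B} B∈𝒯 fix₀ i = begin
    R (opposite i)       ≈⟨ 𝒯.rowSum B∈𝒯 (opposite i) ⟨
    sum (B (opposite i)) ≈⟨ sum-cong-≋ (fix₀ i) ⟩
    sum (B i)            ≈⟨ 𝒯.rowSum B∈𝒯 i ⟩
    R i                  ∎

  vertical-average : Matrix m n → Matrix m n
  vertical-average A i j = half (A i j + A (opposite i) j)

  -- Reflection merely permutes the summands of a column. It moves the sum of row `opposite i` to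
  -- row `i`, which is where the symmetry of `R` enters.
  vertical-average-𝒯 : ∀ {A} → A ∈ 𝒯 R S → (∀ i → R (opposite i) ≃ R i) → vertical-average A ∈ 𝒯 R S
  vertical-average-𝒯 {A} A∈𝒯 R-sym = record
    { nonNegative = λ i j → half-nonNegative (A i j) (A (opposite i) j)
        (𝒯.nonNegative A∈𝒯 i j) (𝒯.nonNegative A∈𝒯 (opposite i) j)
    ; rowSum = λ i → sum-average (A i) (A (opposite i)) {R i} (𝒯.rowSum A∈𝒯 i) (begin
        sum (A (opposite i)) ≈⟨ 𝒯.rowSum A∈𝒯 (opposite i) ⟩
        R (opposite i)       ≈⟨ R-sym i ⟩
        R i                  ∎)
    ; columnSum = λ j → sum-average (λ i → A i j) (λ i → A (opposite i) j) {S j} (𝒯.columnSum A∈𝒯 j) (begin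
        sum (λ i → A (opposite i) j) ≈⟨ sum-permute (λ i → A i j) Permutation.reverse ⟨
        sum (λ i → A i j)            ≈⟨ 𝒯.columnSum A∈𝒯 j ⟩
        S j                          ∎)
    }

  -- The reflection swaps the two summands, so the sequences agree term by term.
  vertical-average-r₀ : ∀ A → Fixed r₀ (vertical-average A)
  vertical-average-r₀ A i j = ≗⇒≃ (vertical-average A (opposite i) j) (vertical-average A i j) λ k →
    cong (½ ℚ.*_) (trans
      (ℚ.+-comm (seq (A (opposite i) j) k) (seq (A (opposite (opposite i)) j) k))
      (cong (λ i′ → seq (A i′ j) k ℚ.+ seq (A (opposite i) j) k) (opposite-involutive i)))

  vertical-average-r∞ : ∀ {A} → Fixed r∞ A → Fixed r∞ (vertical-average A)
  vertical-average-r∞ {A} fix∞ i j =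
    half-cong {A i (opposite j) + A (opposite i) (opposite j)} {A i j + A (opposite i) j}
      (+-cong {A i (opposite j)} {A i j} {A (opposite i) (opposite j)} {A (opposite i) j}
        (fix∞ i j) (fix∞ (opposite i) j))

  𝒯⁺-satisfiable : Satisfiable (𝒯∞ R S) × Satisfiable (𝒯⁰ R S) → Satisfiable (𝒯⁺ R S)
  𝒯⁺-satisfiable ((A , A∈𝒯 , fix∞) , (B , B∈𝒯 , fix₀)) =
    vertical-average A ,
    vertical-average-𝒯 {A} A∈𝒯 (rowSums-symmetric {B} B∈𝒯 fix₀) ,
    fixed-D₊ {A = vertical-average A} (vertical-average-r∞ {A} fix∞) (vertical-average-r₀ A)

  -- Integer matrices: reduction to natural numbers.

  naturalEntries : ∀ {A} → A ∈ 𝒯 R S → IntegerEntries A → ∀ i j → ∃[ k ] (A i j ≃ fromℕ k)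
  naturalEntries {A} A∈𝒯 A∈ℤ i j = integer-nonNegative (A i j) (A∈ℤ i j) (𝒯.nonNegative A∈𝒯 i j)

  fromℕ-𝒯 : (r : Vector ℕ m) (s : Vector ℕ n) (c : Fin m → Vector ℕ n) →
    (∀ i → ℕ-sum (c i) ≡ r i) → (∀ j → ℕ-sum (λ i → c i j) ≡ s j) →
    (∀ i → R i ≃ fromℕ (r i)) → (∀ j → S j ≃ fromℕ (s j)) →
    𝒯 R S (λ i j → fromℕ (c i j))
  fromℕ-𝒯 r s c rows columns R≃r S≃s = record
    { nonNegative = λ i j → 0≤fromℕ (c i j)
    ; rowSum = λ i → begin
        sum (λ j → fromℕ (c i j)) ≈⟨ sum-fromℕ (c i) ⟩
        fromℕ (ℕ-sum (c i))       ≈⟨ fromℕ-cong (ℕ-sum (c i)) (r i) (rows i) ⟩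
        fromℕ (r i)               ≈⟨ R≃r i ⟨
        R i                       ∎
    ; columnSum = λ j → begin
        sum (λ i → fromℕ (c i j))   ≈⟨ sum-fromℕ (λ i → c i j) ⟩
        fromℕ (ℕ-sum (λ i → c i j)) ≈⟨ fromℕ-cong (ℕ-sum (λ i → c i j)) (s j) (columns j) ⟩
        fromℕ (s j)                 ≈⟨ S≃s j ⟨
        S j                         ∎
    }

  𝒯⁺ℤ-satisfiable : Satisfiable (𝒯∞ℤ R S) × Satisfiable (𝒯⁰ℤ R S) → Satisfiable (𝒯⁺ℤ R S)
  𝒯⁺ℤ-satisfiable ((A , (A∈𝒯 , A-fix∞) , A∈ℤ) , (B , (B∈𝒯 , B-fix₀) , B∈ℤ)) =
    let c , c-sym∞ , c-sym₀ , c-rows , c-columns =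
          symmetric-transport r s a b a-sym (λ _ → refl) (λ _ → refl) b-sym b-rows b-columns
    in
    (λ i j → fromℕ (c i j)) ,
    (fromℕ-𝒯 r s c c-rows c-columns R≃r S≃s ,
     fixed-D₊ {A = λ i j → fromℕ (c i j)}
       (λ i j → fromℕ-cong (c i (opposite j)) (c i j) (c-sym∞ i j))
       (λ i j → fromℕ-cong (c (opposite i) j) (c i j) (c-sym₀ j i))) ,
    λ i j → + c i j , ≃-refl {fromℕ (c i j)}
    where
    a b : Fin m → Vector ℕ n
    a i j = proj₁ (naturalEntries {A} A∈𝒯 A∈ℤ i j)
    b i j = proj₁ (naturalEntries {B} B∈𝒯 B∈ℤ i j)

    A≃a : ∀ i j → A i j ≃ fromℕ (a i j)
    A≃a i j = proj₂ (naturalEntries {A} A∈𝒯 A∈ℤ i j)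
    B≃b : ∀ i j → B i j ≃ fromℕ (b i j)
    B≃b i j = proj₂ (naturalEntries {B} B∈𝒯 B∈ℤ i j)

    -- The natural marginals are read off from `a`. Those of `b` agree with them because both
    -- represent the same `R` and `S` and `fromℕ` is injective, which also turns the symmetries of
    -- `A` and `B` into equalities of natural numbers.
    r : Vector ℕ m
    r i = ℕ-sum (a i)
    s : Vector ℕ n
    s j = ℕ-sum (λ i → a i j)

    R≃r : ∀ i → R i ≃ fromℕ (r i)
    R≃r i = sum≃fromℕ (A i) (a i) {R i} (A≃a i) (𝒯.rowSum A∈𝒯 i)
    S≃s : ∀ j → S j ≃ fromℕ (s j)
    S≃s j = sum≃fromℕ (λ i → A i j) (λ i → a i j) {S j} (λ i → A≃a i j) (𝒯.columnSum A∈𝒯 j)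

    a-sym : ∀ i j → a i (opposite j) ≡ a i j
    a-sym i j = fromℕ-injective (a i (opposite j)) (a i j) (begin
      fromℕ (a i (opposite j)) ≈⟨ A≃a i (opposite j) ⟨
      A i (opposite j)         ≈⟨ A-fix∞ i j ⟩
      A i j                    ≈⟨ A≃a i j ⟩
      fromℕ (a i j)            ∎)

    b-sym : ∀ j i → b (opposite i) j ≡ b i j
    b-sym j i = fromℕ-injective (b (opposite i) j) (b i j) (begin
      fromℕ (b (opposite i) j) ≈⟨ B≃b (opposite i) j ⟨
      B (opposite i) j         ≈⟨ B-fix₀ i j ⟩
      B i j                    ≈⟨ B≃b i j ⟩
      fromℕ (b i j)            ∎)

    b-rows : ∀ i → ℕ-sum (b i) ≡ r i
    b-rows i = fromℕ-injective (ℕ-sum (b i)) (r i) (begin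
      fromℕ (ℕ-sum (b i)) ≈⟨ sum≃fromℕ (B i) (b i) {R i} (B≃b i) (𝒯.rowSum B∈𝒯 i) ⟨
      R i                 ≈⟨ R≃r i ⟩
      fromℕ (r i)         ∎)

    b-columns : ∀ j → ℕ-sum (λ i → b i j) ≡ s j
    b-columns j = fromℕ-injective (ℕ-sum (λ i → b i j)) (s j) (begin
      fromℕ (ℕ-sum (λ i → b i j))
        ≈⟨ sum≃fromℕ (λ i → B i j) (λ i → b i j) {S j} (λ i → B≃b i j) (𝒯.columnSum B∈𝒯 j) ⟨
      S j         ≈⟨ S≃s j ⟩
      fromℕ (s j) ∎)

theorem11 : (m n : ℕ) .{{_ : NonZero m}} .{{_ : NonZero n}}
    (R : Vector ℝ m) (S : Vector ℝ n) → sum R ≃ sum S →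
    (Satisfiable (𝒯⁺ R S) ⇔ (Satisfiable (𝒯∞ R S) × Satisfiable (𝒯⁰ R S)))
    ×
    ((∀ i → IsInteger (R i) × 0ℝ ≤ R i) → (∀ j → IsInteger (S j) × 0ℝ ≤ S j) →
    (Satisfiable (𝒯⁺ℤ R S) ⇔ (Satisfiable (𝒯∞ℤ R S) × Satisfiable (𝒯⁰ℤ R S))))
theorem11 m n R S _ =
  mk⇔ (λ (A , A∈𝒯 , fixed) → (A , A∈𝒯 , fixed r∞) , (A , A∈𝒯 , fixed r₀))
      (𝒯⁺-satisfiable R S) ,
  λ _ _ → mk⇔
    (λ (A , (A∈𝒯 , fixed) , A∈ℤ) → (A , (A∈𝒯 , fixed r∞) , A∈ℤ) , (A , (A∈𝒯 , fixed r₀) , A∈ℤ))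
    (𝒯⁺ℤ-satisfiable R S)
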